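{- Let $d,k \in \mathbf{N}$ with $d \geq 2k + 6$ and let $\alpha \in (0,1)$. There exist $q_0 = q_0(\alpha,k)$ and $c = c(\alpha,k) > 0$ such that the following holds for every odd prime power $q \geq q_0$: if $\lambda \in \mathbf{F}_q^*$ and $A \subseteq S_\lambda$ with $|A| \geq \alpha q^{d - 1}$, then for every $(k+2)$-point spherical configuration $X\subseteq\mathbf{F}_q^d$ spanning $k$ dimensions, $A$ contains at least $c\,q^{(k + 1)d - (k+1)(k + 2)/2}$ isometric copies of $X$.
   Context: $\mathbf{F}_q$ is a finite field of odd characteristic, $\mathbf{F}_q^*=\mathbf{F}_q\setminus\{0\}$. For $v,w\in\mathbf{F}_q^d$, $v\cdot w=\sum_{j=1}^d v_jw_j$ and $|v|^2 := v\cdot v$. For $u\in\mathbf{F}_q^d$ and $\lambda\in\mathbf{F}_q$, $S_\lambda(u)=\{x\in\mathbf{F}_q^d : |x-u|^2=\lambda\}$ and $S_\lambda = S_\lambda(0)$. A finite set $X\subseteq\mathbf{F}_q^d$ spans $k$ dimensions if $\dim \operatorname{Span}(X-X)=k$, and is spherical if $X\subseteq S_\mu(u)$ for some $u\in\mathbf{F}_q^d$, $\mu\in\mathbf{F}_q$. Two sets $X,X'$ are isometric if there is a bijection $\phi:X\to X'$ with $|\phi(x)-\phi(x')|^2=|x-x'|^2$ for all $x,x'\in X$; an isometric copy of $X$ in $A$ is a subset of $A$ isometric to $X$. -}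

module Defs where

open import Level using (0ℓ)
open import Data.Nat as ℕ using (ℕ; zero; suc)
open import Data.Fin using (Fin)
import Data.Fin as Fin
open import Data.Vec using (Vec; []; _∷_; zipWith; foldr′; replicate; map)
open import Data.List using (List; length)
open import Data.List.Relation.Unary.All using (All)
open import Data.List.Relation.Unary.AllPairs using (AllPairs)
open import Data.Product using (Σ; ∃; _×_; _,_)
open import Relation.Binary.PropositionalEquality using (_≡_; _≢_)
open import Relation.Nullary using (¬_)
open import Function.Bundles using (_↔_)
open import Function.Definitions using (Injective)
open import Algebra.Structures using (IsCommutativeRing)

record FiniteField : Set₁ where
  field
    Carrier : Set
    _+_ _*_ : Carrier → Carrier → Carrier
    -_      : Carrier → Carrier
    0# 1#   : Carrier
    isCommutativeRing : IsCommutativeRing _≡_ _+_ _*_ -_ 0# 1#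
    0≢1     : 0# ≢ 1#
    inverse : ∀ x → x ≢ 0# → ∃ λ y → x * y ≡ 1#
    size    : ℕ
    enum    : Carrier ↔ Fin size

module FieldOps (𝔽 : FiniteField) where
  open FiniteField 𝔽

  Pt : ℕ → Set
  Pt d = Vec Carrier d

  _⊖_ : ∀ {d} → Pt d → Pt d → Pt d
  v ⊖ w = zipWith (λ a b → a + (- b)) v w

  _⊕_ : ∀ {d} → Pt d → Pt d → Pt d
  v ⊕ w = zipWith _+_ v w

  _•_ : ∀ {d} → Carrier → Pt d → Pt d
  c • v = map (c *_) v

  _·_ : ∀ {d} → Pt d → Pt d → Carrier
  v · w = foldr′ _+_ 0# (zipWith _*_ v w)

  ∣_∣² : ∀ {d} → Pt d → Carrier
  ∣ v ∣² = v · v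

  zeroV : ∀ {d} → Pt d
  zeroV = replicate _ 0#

  lincomb : ∀ {d n} → (Fin n → Carrier) → (Fin n → Pt d) → Pt d
  lincomb {n = zero}  c v = zeroV
  lincomb {n = suc n} c v = (c Fin.zero • v Fin.zero) ⊕ lincomb (λ l → c (Fin.suc l)) (λ l → v (Fin.suc l))

  InSpan : ∀ {d} → (Pt d → Set) → Pt d → Set
  InSpan {d} S w = Σ ℕ λ n → Σ (Fin n → Carrier) λ c → Σ (Fin n → Pt d) λ v →
                     (∀ l → S (v l)) × lincomb c v ≡ w

  LinIndep : ∀ {d k} → (Fin k → Pt d) → Set
  LinIndep v = ∀ c → lincomb c v ≡ zeroV → ∀ l → c l ≡ 0#

  DimSpan : ∀ {d} → (Pt d → Set) → ℕ → Set
  DimSpan {d} S k = Σ (Fin k → Pt d) λ v →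
                      (∀ l → InSpan S (v l)) × LinIndep v ×
                      (∀ w → InSpan S w → InSpan (λ u → ∃ λ l → v l ≡ u) w)

  DiffSet : ∀ {d m} → (Fin m → Pt d) → Pt d → Set
  DiffSet X w = ∃ λ i → ∃ λ j → X i ⊖ X j ≡ w

  SpansDims : ∀ {d m} → (Fin m → Pt d) → ℕ → Set
  SpansDims X k = DimSpan (DiffSet X) k

  Spherical : ∀ {d m} → (Fin m → Pt d) → Set
  Spherical {d} X = Σ (Pt d) λ u → Σ Carrier λ μ → ∀ i → ∣ X i ⊖ u ∣² ≡ μ

  InSphere : ∀ {d} → Carrier → Pt d → Set
  InSphere λ' x = ∣ x ∣² ≡ λ'

  -- A contains at least the elements of a duplicate-free list of length ℓ:
  -- "|A| ≥ N" means there is such a list with N ≤ ℓ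
  DistinctElems : ∀ {d} → (Pt d → Set) → List (Pt d) → Set
  DistinctElems A xs = AllPairs _≢_ xs × All A xs

  -- y : Fin m → Pt d parametrises an isometric copy of X in A:
  -- the set {y_i} ⊆ A with the bijection x_i ↦ y_i preserving |·-·|²
  IsCopy : ∀ {d m} → (Pt d → Set) → (Fin m → Pt d) → (Fin m → Pt d) → Set
  IsCopy A X y = Injective _≡_ _≡_ y × (∀ i → A (y i)) ×
                 (∀ i j → ∣ y i ⊖ y j ∣² ≡ ∣ X i ⊖ X j ∣²)

  SameSet : ∀ {d m} → (Fin m → Pt d) → (Fin m → Pt d) → Set
  SameSet y y' = (∀ i → ∃ λ j → y i ≡ y' j) × (∀ j → ∃ λ i → y' j ≡ y i)

  DistinctCopies : ∀ {d m} → (Pt d → Set) → (Fin m → Pt d) → List (Fin m → Pt d) → Set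
  DistinctCopies A X ys = AllPairs (λ y y' → ¬ SameSet y y') ys × All (IsCopy A X) ys

{-# OPTIONS --safe #-}
module Submission where

-- A copy of X need not be an affine image of X: it only has to realise the
-- distances of X, which on S_λ amounts to prescribing dot products. For a
-- finite L ⊆ S_λ with n points, the number deg(x) of y ∈ L on the hyperplane
-- x · y = g has mean n / q over all x ∈ F^d, and because two such hyperplanes
-- meet in q^(d-2) points unless y' = ± y, its variance is so small that at
-- most 8 q^(d+1) / n points x have q deg(x) < n / 2. Split A into k + 2
-- disjoint parts, choose y₀ in the first part with many neighbours in all the
-- others, pass to those neighbourhoods, and iterate; each step costs a factor
-- 2 q in the size of the parts. Disjointness of the parts makes the vertices
-- of a copy distinct, and makes different tuples different as sets.

open import Defs
open import Level using (0ℓ)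
open import Algebra.Bundles using (CommutativeRing)
open import Data.Nat using (ℕ; zero; suc; pred; _+_; _*_; _∸_; _^_; _/_; _≤_; _<_; z≤n; s≤s; _≤?_; _<?_; NonZero; >-nonZero)
open import Data.Nat.Properties hiding (_≟_)
open import Data.Nat.DivMod using (m*n/n≡m; /-congˡ)
open import Data.Nat.Divisibility using (_∣_)
open import Data.Nat.ListAction using (sum)
open import Data.Nat.Tactic.RingSolver using (solve-∀)
open import Data.Fin using (Fin; zero; suc)
import Data.Fin as Fin
import Data.Fin.Properties as Fin
open import Data.List using (List; []; _∷_; _++_; length; map; filter; take; drop; allFin; cartesianProductWith)
open import Data.List.Properties using (map-∘; length-map; length-++; length-take; length-drop; length-tabulate; take++drop≡id)
open import Data.List.Membership.Propositional using (_∈_)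
open import Data.List.Membership.Propositional.Properties using (∈-allFin; ∈-map⁺; ∈-cartesianProductWith⁺; ∈-filter⁻; ∈-++⁺ˡ; ∈-++⁺ʳ)
open import Data.List.Relation.Unary.Any using (here; there)
open import Data.List.Relation.Unary.All as All using (All; []; _∷_)
import Data.List.Relation.Unary.All.Properties as All
open import Data.List.Relation.Unary.AllPairs as AllPairs using (AllPairs; []; _∷_)
import Data.List.Relation.Unary.AllPairs.Properties as AllPairs
open import Data.List.Relation.Unary.Unique.Propositional using (Unique)
import Data.List.Relation.Unary.Unique.Propositional.Properties as Unique
open import Data.Maybe using (nothing)
open import Data.Product using (Σ; ∃; _×_; _,_; proj₁; proj₂)
open import Data.Sum using (_⊎_; inj₁; inj₂)
open import Data.Vec using ([]; _∷_)
import Data.Vec.Properties as Vec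
import Data.Vec.Functional as Vector
open import Function.Bundles using (Inverse)
open import Function.Definitions using (Injective)
open import Relation.Nullary using (¬_; Dec; yes; no; contradiction)
open import Relation.Nullary.Decidable using (map′)
open import Relation.Unary using (Decidable)
open import Relation.Binary using (DecidableEquality; tri<; tri≈; tri>)
open import Relation.Binary.PropositionalEquality
import Tactic.RingSolver.Core.AlmostCommutativeRing as ACR
import Tactic.RingSolver.NonReflective as RingSolver

-- Finite sums over lists and indicator functions.

private variable
  S T : Set
  P Q : Set

∑ : List S → (S → ℕ) → ℕ
∑ xs f = sum (map f xs)

∑-cong : ∀ (xs : List S) {f g} → (∀ x → f x ≡ g x) → ∑ xs f ≡ ∑ xs g
∑-cong []       f≗g = refl
∑-cong (x ∷ xs) f≗g = cong₂ _+_ (f≗g x) (∑-cong xs f≗g)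

∑-mono : ∀ (xs : List S) {f g} → (∀ {x} → x ∈ xs → f x ≤ g x) → ∑ xs f ≤ ∑ xs g
∑-mono []       f≤g = z≤n
∑-mono (x ∷ xs) f≤g = +-mono-≤ (f≤g (here refl)) (∑-mono xs λ x∈ → f≤g (there x∈))

∑-+ : ∀ (xs : List S) f g → ∑ xs (λ x → f x + g x) ≡ ∑ xs f + ∑ xs g
∑-+ []       f g = refl
∑-+ (x ∷ xs) f g rewrite ∑-+ xs f g = interchange (f x) (g x) (∑ xs f) (∑ xs g)
  where
  interchange : ∀ a b c d → a + b + (c + d) ≡ a + c + (b + d)
  interchange = solve-∀

∑-*ˡ : ∀ (xs : List S) c f → ∑ xs (λ x → c * f x) ≡ c * ∑ xs f
∑-*ˡ []       c f = sym (*-zeroʳ c)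
∑-*ˡ (x ∷ xs) c f rewrite ∑-*ˡ xs c f = sym (*-distribˡ-+ c (f x) (∑ xs f))

∑-*ʳ : ∀ (xs : List S) c f → ∑ xs (λ x → f x * c) ≡ ∑ xs f * c
∑-*ʳ []       c f = refl
∑-*ʳ (x ∷ xs) c f rewrite ∑-*ʳ xs c f = sym (*-distribʳ-+ c (f x) (∑ xs f))

∑-const : ∀ (xs : List S) c → ∑ xs (λ _ → c) ≡ length xs * c
∑-const []       c = refl
∑-const (x ∷ xs) c = cong (c +_) (∑-const xs c)

∑-swap : ∀ (xs : List S) (ys : List T) (f : S → T → ℕ) →
         ∑ xs (λ x → ∑ ys (f x)) ≡ ∑ ys (λ y → ∑ xs λ x → f x y)
∑-swap []       ys f = sym (trans (∑-const ys 0) (*-zeroʳ (length ys)))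
∑-swap (x ∷ xs) ys f rewrite ∑-swap xs ys f =
  sym (∑-+ ys (f x) λ y → ∑ xs λ x → f x y)

∈⇒≤∑ : ∀ {xs : List S} {x} f → x ∈ xs → f x ≤ ∑ xs f
∈⇒≤∑ f (here refl) = m≤m+n _ _
∈⇒≤∑ f (there x∈)  = ≤-trans (∈⇒≤∑ f x∈) (m≤n+m _ _)

⟦_⟧ : Dec P → ℕ
⟦ yes _ ⟧ = 1
⟦ no  _ ⟧ = 0

⟦⟧-cong : (P? : Dec P) (Q? : Dec Q) → (P → Q) → (Q → P) → ⟦ P? ⟧ ≡ ⟦ Q? ⟧
⟦⟧-cong (yes _) (yes _) _ _ = refl
⟦⟧-cong (no _)  (no _)  _ _ = refl
⟦⟧-cong (yes p) (no ¬q) f _ = contradiction (f p) ¬q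
⟦⟧-cong (no ¬p) (yes q) _ g = contradiction (g q) ¬p

⟦⟧-yes : (P? : Dec P) → P → ⟦ P? ⟧ ≡ 1
⟦⟧-yes (yes _) _ = refl
⟦⟧-yes (no ¬p) p = contradiction p ¬p

⟦⟧-no : (P? : Dec P) → ¬ P → ⟦ P? ⟧ ≡ 0
⟦⟧-no (yes p) ¬p = contradiction p ¬p
⟦⟧-no (no _)  _  = refl

⟦⟧-≤1 : (P? : Dec P) → ⟦ P? ⟧ ≤ 1
⟦⟧-≤1 (yes _) = ≤-refl
⟦⟧-≤1 (no _)  = z≤n

length-filter : ∀ {P : S → Set} (P? : Decidable P) xs →
                length (filter P? xs) ≡ ∑ xs (λ x → ⟦ P? x ⟧)
length-filter P? [] = refl
length-filter P? (x ∷ xs) with P? x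
... | yes _ = cong suc (length-filter P? xs)
... | no  _ = length-filter P? xs

-- Multiplicities in lists and change of the summation variable.

module Multiplicity (_≟_ : DecidableEquality S) where

  mult : S → List S → ℕ
  mult x xs = ∑ xs (λ z → ⟦ z ≟ x ⟧)

  mult-∉ : ∀ {x} xs → All (x ≢_) xs → mult x xs ≡ 0
  mult-∉ []       []         = refl
  mult-∉ (z ∷ xs) (x≢z ∷ x∉) rewrite ⟦⟧-no (z ≟ _) (λ eq → x≢z (sym eq)) = mult-∉ xs x∉

  Unique⇒mult≤1 : ∀ {xs} x → Unique xs → mult x xs ≤ 1
  Unique⇒mult≤1 x [] = z≤n
  Unique⇒mult≤1 {z ∷ xs} x (z∉xs ∷ u) with z ≟ x
  ... | yes refl = s≤s (≤-reflexive (mult-∉ xs z∉xs))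
  ... | no  _    = Unique⇒mult≤1 x u

  ∈⇒1≤mult : ∀ {xs x} → x ∈ xs → 1 ≤ mult x xs
  ∈⇒1≤mult {xs} {x} x∈ =
    ≤-trans (≤-reflexive (sym (⟦⟧-yes (x ≟ x) refl))) (∈⇒≤∑ (λ z → ⟦ z ≟ x ⟧) x∈)

  -- A count, rather than membership together with uniqueness, so that it evaluates a sum of
  -- indicators at once.
  Exhaustive : List S → Set
  Exhaustive xs = ∀ x → mult x xs ≡ 1

  Unique∧∈⇒Exhaustive : ∀ {xs} → Unique xs → (∀ x → x ∈ xs) → Exhaustive xs
  Unique∧∈⇒Exhaustive u all x = ≤-antisym (Unique⇒mult≤1 x u) (∈⇒1≤mult (all x))

  -- Write each `f x` as a sum over `all` of `f z` times the indicator of z = x, then exchange the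
  -- sums. The list `xs` survives only as a weight on `all`.
  ∑-via-mult : ∀ all → Exhaustive all → ∀ xs f →
               ∑ xs f ≡ ∑ all (λ z → mult z xs * f z)
  ∑-via-mult all ex xs f = begin
    ∑ xs f                                          ≡⟨ ∑-cong xs pick ⟩
    ∑ xs (λ x → ∑ all λ z → ⟦ x ≟ z ⟧ * f z)        ≡⟨ ∑-swap xs all _ ⟩
    ∑ all (λ z → ∑ xs λ x → ⟦ x ≟ z ⟧ * f z)        ≡⟨ ∑-cong all (λ z → ∑-*ʳ xs (f z) _) ⟩
    ∑ all (λ z → mult z xs * f z)                   ∎
    where
    open ≡-Reasoning
    same : ∀ x z → ⟦ x ≟ z ⟧ * f z ≡ ⟦ z ≟ x ⟧ * f x
    same x z with x ≟ z | z ≟ x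
    ... | yes refl | yes _   = refl
    ... | no  _    | no  _   = refl
    ... | yes eq   | no  neq = contradiction (sym eq) neq
    ... | no  neq  | yes eq  = contradiction (sym eq) neq
    pick : ∀ x → f x ≡ ∑ all (λ z → ⟦ x ≟ z ⟧ * f z)
    pick x = sym (trans (∑-cong all (same x)) (trans (∑-*ʳ all (f x) _)
               (trans (cong (_* f x) (ex x)) (*-identityˡ (f x)))))

  ∑-Unique-≤ : ∀ all → Exhaustive all → ∀ {xs} → Unique xs → ∀ f → ∑ xs f ≤ ∑ all f
  ∑-Unique-≤ all ex {xs} u f = begin
    ∑ xs f                        ≡⟨ ∑-via-mult all ex xs f ⟩
    ∑ all (λ z → mult z xs * f z) ≤⟨ ∑-mono all (λ {z} _ → *-monoˡ-≤ (f z) (Unique⇒mult≤1 z u)) ⟩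
    ∑ all (λ z → 1 * f z)         ≡⟨ ∑-cong all (λ z → *-identityˡ (f z)) ⟩
    ∑ all f                       ∎
    where open ≤-Reasoning

  -- The image of `all` under `φ` has weight 1 everywhere, because `φ x` equals `z` exactly when `x`
  -- equals `ψ z`.
  ∑-reindex : ∀ all → Exhaustive all → (φ ψ : S → S) →
              (∀ x → φ (ψ x) ≡ x) → (∀ x → ψ (φ x) ≡ x) →
              ∀ f → ∑ all (λ x → f (φ x)) ≡ ∑ all f
  ∑-reindex all ex φ ψ φψ ψφ f = begin
    ∑ all (λ x → f (φ x))                                       ≡⟨ cong sum (map-∘ all) ⟩
    ∑ (map φ all) f                                             ≡⟨ ∑-via-mult all ex (map φ all) f ⟩
    ∑ all (λ z → mult z (map φ all) * f z)                      ≡⟨ ∑-cong all (λ z → trans (cong (_* f z) (mult-map z)) (*-identityˡ (f z))) ⟩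
    ∑ all f                                                     ∎
    where
    open ≡-Reasoning
    mult-map : ∀ z → mult z (map φ all) ≡ 1
    mult-map z = trans (cong sum (sym (map-∘ all)))
      (trans (∑-cong all λ x → ⟦⟧-cong (φ x ≟ z) (x ≟ ψ z)
                (λ eq → trans (sym (ψφ x)) (cong ψ eq))
                (λ eq → trans (cong φ eq) (φψ z)))
             (ex (ψ z)))

length-cartesianProductWith : ∀ {A B C : Set} (f : A → B → C) xs ys →
                              length (cartesianProductWith f xs ys) ≡ length xs * length ys
length-cartesianProductWith f []       ys = refl
length-cartesianProductWith f (x ∷ xs) ys = trans (length-++ (map (f x) ys))
  (cong₂ _+_ (length-map (f x) ys) (length-cartesianProductWith f xs ys))

-- Field arithmetic, the dot product, and hyperplanes in the enumerated space.

module Geometry (𝔽 : FiniteField) where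
  open FiniteField 𝔽 using (Carrier; 0#; 1#; inverse; enum; isCommutativeRing)
    renaming (_+_ to infixl 6 _⊞_; _*_ to infixl 7 _⊠_; -_ to infix 8 ⊟_; size to q)
  open FieldOps 𝔽 public

  F : CommutativeRing 0ℓ 0ℓ
  F = record { isCommutativeRing = isCommutativeRing }

  open CommutativeRing F public using ()
    renaming (+-identityˡ to ⊞-identityˡ; +-identityʳ to ⊞-identityʳ; *-identityˡ to ⊠-identityˡ;
              *-identityʳ to ⊠-identityʳ; zeroˡ to ⊠-zeroˡ; zeroʳ to ⊠-zeroʳ; *-assoc to ⊠-assoc;
              *-comm to ⊠-comm; +-comm to ⊞-comm; +-assoc to ⊞-assoc; -‿inverseˡ to ⊟-inverseˡ;
              -‿inverseʳ to ⊟-inverseʳ; distribʳ to ⊠-distribʳ-⊞; distribˡ to ⊠-distribˡ-⊞)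
  open import Algebra.Properties.Group (CommutativeRing.+-group F) using (∙-cancelʳ)
  open RingSolver (ACR.fromCommutativeRing F (λ _ → nothing)) using (solve)
    renaming (_⊕_ to infixl 6 _:+_; _⊗_ to infixl 7 _:*_; _⊜_ to infix 4 _:=_)

  _≟F_ : DecidableEquality Carrier
  x ≟F y = map′ (λ eq → trans (sym (E.strictlyInverseʳ x)) (trans (cong E.from eq) (E.strictlyInverseʳ y)))
                (cong E.to) (E.to x Fin.≟ E.to y)
    where module E = Inverse enum

  _≟_ : ∀ {d} → DecidableEquality (Pt d)
  _≟_ = Vec.≡-dec _≟F_

  ⊞-⊟-cancelʳ : ∀ x y → (x ⊞ ⊟ y) ⊞ y ≡ x
  ⊞-⊟-cancelʳ x y = trans (⊞-assoc x _ y) (trans (cong (x ⊞_) (⊟-inverseˡ y)) (⊞-identityʳ x))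

  ⊠-cancelˡ : ∀ {x} y z → x ≢ 0# → x ⊠ y ≡ x ⊠ z → y ≡ z
  ⊠-cancelˡ {x} y z x≢0 eq with x⁻¹ , xx⁻¹ ← inverse x x≢0 = begin
    y               ≡⟨ undo y ⟨
    x⁻¹ ⊠ (x ⊠ y)   ≡⟨ cong (x⁻¹ ⊠_) eq ⟩
    x⁻¹ ⊠ (x ⊠ z)   ≡⟨ undo z ⟩
    z               ∎
    where
    open ≡-Reasoning
    undo : ∀ w → x⁻¹ ⊠ (x ⊠ w) ≡ w
    undo w = trans (sym (⊠-assoc x⁻¹ x w))
      (trans (cong (_⊠ w) (trans (⊠-comm x⁻¹ x) xx⁻¹)) (⊠-identityˡ w))

  -- From x² = 1 follows (x + 1) x = x + 1, and the factor x + 1 can be cancelled unless x = -1.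
  square-one : ∀ x → x ⊠ x ≡ 1# → x ≡ 1# ⊎ x ≡ ⊟ 1#
  square-one x x²≡1 with x ≟F (⊟ 1#)
  ... | yes x≡-1 = inj₂ x≡-1
  ... | no  x≢-1 = inj₁ (⊠-cancelˡ x 1# x+1≢0 (begin
      (x ⊞ 1#) ⊠ x    ≡⟨ ⊠-distribʳ-⊞ x x 1# ⟩
      x ⊠ x ⊞ 1# ⊠ x  ≡⟨ cong₂ _⊞_ x²≡1 (⊠-identityˡ x) ⟩
      1# ⊞ x          ≡⟨ ⊞-comm 1# x ⟩
      x ⊞ 1#          ≡⟨ ⊠-identityʳ _ ⟨
      (x ⊞ 1#) ⊠ 1#   ∎))
    where
    open ≡-Reasoning
    x+1≢0 : x ⊞ 1# ≢ 0#
    x+1≢0 eq = x≢-1 (∙-cancelʳ 1# x (⊟ 1#) (trans eq (sym (⊟-inverseˡ 1#))))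

  dot-comm : ∀ {d} (v w : Pt d) → v · w ≡ w · v
  dot-comm []      []      = refl
  dot-comm (a ∷ v) (b ∷ w) = cong₂ _⊞_ (⊠-comm a b) (dot-comm v w)

  dot-⊕ˡ : ∀ {d} (v w u : Pt d) → (v ⊕ w) · u ≡ (v · u) ⊞ (w · u)
  dot-⊕ˡ []      []      []      = sym (⊞-identityˡ 0#)
  dot-⊕ˡ (a ∷ v) (b ∷ w) (c ∷ u) rewrite dot-⊕ˡ v w u =
    solve 5 (λ a b c x y → (a :+ b) :* c :+ (x :+ y) := (a :* c :+ x) :+ (b :* c :+ y))
      refl a b c (v · u) (w · u)

  dot-⊕ʳ : ∀ {d} (u v w : Pt d) → u · (v ⊕ w) ≡ (u · v) ⊞ (u · w)
  dot-⊕ʳ u v w = trans (dot-comm u (v ⊕ w))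
    (trans (dot-⊕ˡ v w u) (cong₂ _⊞_ (dot-comm v u) (dot-comm w u)))

  dot-•ˡ : ∀ {d} c (v u : Pt d) → (c • v) · u ≡ c ⊠ (v · u)
  dot-•ˡ c []      []      = sym (⊠-zeroʳ c)
  dot-•ˡ c (a ∷ v) (b ∷ u) rewrite dot-•ˡ c v u =
    trans (cong (_⊞ c ⊠ (v · u)) (⊠-assoc c a b)) (sym (⊠-distribˡ-⊞ c (a ⊠ b) (v · u)))

  dot-•ʳ : ∀ {d} c (u v : Pt d) → u · (c • v) ≡ c ⊠ (u · v)
  dot-•ʳ c u v = trans (dot-comm u (c • v)) (trans (dot-•ˡ c v u) (cong (c ⊠_) (dot-comm v u)))

  ⊖-⊕-cancel : ∀ {d} (v w : Pt d) → (v ⊖ w) ⊕ w ≡ v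
  ⊖-⊕-cancel []      []      = refl
  ⊖-⊕-cancel (a ∷ v) (b ∷ w) = cong₂ _∷_ (⊞-⊟-cancelʳ a b) (⊖-⊕-cancel v w)

  -- Lets a configuration be recentred at the centre of its sphere without changing its distances.
  ⊖-⊖-cancel : ∀ {d} (v w u : Pt d) → (v ⊖ u) ⊖ (w ⊖ u) ≡ v ⊖ w
  ⊖-⊖-cancel []      []      []      = refl
  ⊖-⊖-cancel (a ∷ v) (b ∷ w) (c ∷ u) = cong₂ _∷_ eq (⊖-⊖-cancel v w u)
    where
    open ≡-Reasoning
    eq : (a ⊞ ⊟ c) ⊞ ⊟ (b ⊞ ⊟ c) ≡ a ⊞ ⊟ b
    eq = ∙-cancelʳ (b ⊞ ⊟ c) _ _ (begin
      ((a ⊞ ⊟ c) ⊞ ⊟ (b ⊞ ⊟ c)) ⊞ (b ⊞ ⊟ c)  ≡⟨ ⊞-⊟-cancelʳ _ _ ⟩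
      a ⊞ ⊟ c                                 ≡⟨ cong (_⊞ ⊟ c) (⊞-⊟-cancelʳ a b) ⟨
      ((a ⊞ ⊟ b) ⊞ b) ⊞ ⊟ c                   ≡⟨ ⊞-assoc _ b (⊟ c) ⟩
      (a ⊞ ⊟ b) ⊞ (b ⊞ ⊟ c)                   ∎)

  -- Substitute v = t + w with t = v - w: both sides become |t|² + 2 t · w + 2 |w|².
  polarisation : ∀ {d} (v w : Pt d) →
                 ∣ v ⊖ w ∣² ⊞ ((v · w) ⊞ (v · w)) ≡ ∣ v ∣² ⊞ ∣ w ∣²
  polarisation v w = begin
    ∣ t ∣² ⊞ ((v · w) ⊞ (v · w))              ≡⟨ cong (λ p → ∣ t ∣² ⊞ (p ⊞ p)) vw ⟩
    ∣ t ∣² ⊞ ((s ⊞ ∣ w ∣²) ⊞ (s ⊞ ∣ w ∣²))    ≡⟨ rearrange ∣ t ∣² s ∣ w ∣² ⟩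
    ((∣ t ∣² ⊞ s) ⊞ (s ⊞ ∣ w ∣²)) ⊞ ∣ w ∣²    ≡⟨ cong (_⊞ ∣ w ∣²) vv ⟨
    ∣ v ∣² ⊞ ∣ w ∣²                           ∎
    where
    open ≡-Reasoning
    t = v ⊖ w
    s = t · w
    rearrange : ∀ a b c → a ⊞ ((b ⊞ c) ⊞ (b ⊞ c)) ≡ ((a ⊞ b) ⊞ (b ⊞ c)) ⊞ c
    rearrange a b c =
      solve 3 (λ a b c → a :+ ((b :+ c) :+ (b :+ c)) := ((a :+ b) :+ (b :+ c)) :+ c) refl a b c
    vw : v · w ≡ s ⊞ ∣ w ∣²
    vw = trans (cong (_· w) (sym (⊖-⊕-cancel v w))) (dot-⊕ˡ t w w)
    vv : ∣ v ∣² ≡ (∣ t ∣² ⊞ s) ⊞ (s ⊞ ∣ w ∣²)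
    vv = begin
      ∣ v ∣²                                       ≡⟨ cong ∣_∣² (⊖-⊕-cancel v w) ⟨
      (t ⊕ w) · (t ⊕ w)                            ≡⟨ dot-⊕ˡ t w (t ⊕ w) ⟩
      (t · (t ⊕ w)) ⊞ (w · (t ⊕ w))                ≡⟨ cong₂ _⊞_ (dot-⊕ʳ t t w) (dot-⊕ʳ w t w) ⟩
      (∣ t ∣² ⊞ s) ⊞ ((w · t) ⊞ ∣ w ∣²)            ≡⟨ cong (λ p → (∣ t ∣² ⊞ s) ⊞ (p ⊞ ∣ w ∣²)) (dot-comm w t) ⟩
      (∣ t ∣² ⊞ s) ⊞ (s ⊞ ∣ w ∣²)                  ∎

  ⊕-•-inverse : ∀ {d} s t (x e : Pt d) → s ⊞ t ≡ 0# → (x ⊕ (s • e)) ⊕ (t • e) ≡ x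
  ⊕-•-inverse s t []      []      _  = refl
  ⊕-•-inverse s t (a ∷ x) (c ∷ e) eq = cong₂ _∷_ head (⊕-•-inverse s t x e eq)
    where
    open ≡-Reasoning
    head : (a ⊞ s ⊠ c) ⊞ t ⊠ c ≡ a
    head = begin
      (a ⊞ s ⊠ c) ⊞ t ⊠ c  ≡⟨ solve 4 (λ a s t c → (a :+ s :* c) :+ t :* c := a :+ (s :+ t) :* c) refl a s t c ⟩
      a ⊞ (s ⊞ t) ⊠ c      ≡⟨ cong (λ z → a ⊞ z ⊠ c) eq ⟩
      a ⊞ 0# ⊠ c           ≡⟨ cong (a ⊞_) (⊠-zeroˡ c) ⟩
      a ⊞ 0#               ≡⟨ ⊞-identityʳ a ⟩
      a                    ∎

  1•-identity : ∀ {d} (v : Pt d) → 1# • v ≡ v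
  1•-identity []      = refl
  1•-identity (a ∷ v) = cong₂ _∷_ (⊠-identityˡ a) (1•-identity v)

  zeroV-⊕ : ∀ {d} (v : Pt d) → zeroV ⊕ v ≡ v
  zeroV-⊕ []      = refl
  zeroV-⊕ (a ∷ v) = cong₂ _∷_ (⊞-identityˡ a) (zeroV-⊕ v)

  zeroV-dot : ∀ {d} (v : Pt d) → zeroV · v ≡ 0#
  zeroV-dot []      = refl
  zeroV-dot (a ∷ v) rewrite zeroV-dot v = trans (⊞-identityʳ _) (⊠-zeroˡ a)

  -- Invert a non-zero coordinate of `w`. A multiple of `w` would not do in general, since `w · w`
  -- can vanish for a non-zero `w`.
  dual : ∀ {d} (w : Pt d) → w ≢ zeroV → ∃ λ f → f · w ≡ 1#
  dual []      w≢0 = contradiction refl w≢0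
  dual (a ∷ w) w≢0 with a ≟F 0#
  ... | no  a≢0  with a⁻¹ , aa⁻¹ ← inverse a a≢0 =
        (a⁻¹ ∷ zeroV) , trans (cong₂ _⊞_ (trans (⊠-comm a⁻¹ a) aa⁻¹) (zeroV-dot w)) (⊞-identityʳ 1#)
  ... | yes refl with f , fw ← dual w (λ { refl → w≢0 refl }) =
        (0# ∷ f) , trans (cong₂ _⊞_ (⊠-zeroˡ 0#) fw) (⊞-identityˡ 1#)

  elements : List Carrier
  elements = map (Inverse.from enum) (allFin q)

  points : ∀ d → List (Pt d)
  points zero    = [] ∷ []
  points (suc d) = cartesianProductWith _∷_ elements (points d)

  module MultF = Multiplicity _≟F_
  module Mult {d} = Multiplicity (_≟_ {d})

  length-elements : length elements ≡ q
  length-elements = trans (length-map (Inverse.from enum) (allFin q)) (length-tabulate {n = q} (λ i → i))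

  length-points : ∀ d → length (points d) ≡ q ^ d
  length-points zero    = refl
  length-points (suc d) = trans (length-cartesianProductWith _∷_ elements (points d))
                                (cong₂ _*_ length-elements (length-points d))

  elements-Unique : Unique elements
  elements-Unique = Unique.map⁺ from-injective (Unique.allFin⁺ q)
    where
    module E = Inverse enum
    from-injective : ∀ {i j} → E.from i ≡ E.from j → i ≡ j
    from-injective {i} {j} eq =
      trans (sym (E.strictlyInverseˡ i)) (trans (cong E.to eq) (E.strictlyInverseˡ j))

  ∈-elements : ∀ x → x ∈ elements
  ∈-elements x = subst (_∈ elements) (Inverse.strictlyInverseʳ enum x)
                       (∈-map⁺ (Inverse.from enum) (∈-allFin (Inverse.to enum x)))

  points-Unique : ∀ d → Unique (points d)
  points-Unique zero    = [] ∷ []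
  points-Unique (suc d) = Unique.cartesianProductWith⁺ _∷_ Vec.∷-injective elements-Unique (points-Unique d)

  ∈-points : ∀ {d} (x : Pt d) → x ∈ points d
  ∈-points []      = here refl
  ∈-points (a ∷ x) = ∈-cartesianProductWith⁺ _∷_ (∈-elements a) (∈-points x)

  elements-Exhaustive : MultF.Exhaustive elements
  elements-Exhaustive = MultF.Unique∧∈⇒Exhaustive elements-Unique ∈-elements

  points-Exhaustive : ∀ d → Mult.Exhaustive (points d)
  points-Exhaustive d = Mult.Unique∧∈⇒Exhaustive (points-Unique d) ∈-points

  -- Translations along e permute the fibres of x ↦ x · y transitively.
  ∑-hyperplane : ∀ {d} (e y : Pt d) (f : Pt d → ℕ) → e · y ≡ 1# →
                 (∀ t x → f (x ⊕ (t • e)) ≡ f x) → ∀ g →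
                 q * ∑ (points d) (λ x → f x * ⟦ (x · y) ≟F g ⟧) ≡ ∑ (points d) f
  ∑-hyperplane {d} e y f ey≡1 f-invariant g = sym (begin
    ∑ pts f                                                             ≡⟨ ∑-cong pts split ⟩
    ∑ pts (λ x → ∑ elements λ a → f x * ⟦ (x · y) ≟F a ⟧)               ≡⟨ ∑-swap pts elements _ ⟩
    ∑ elements (λ a → ∑ pts λ x → f x * ⟦ (x · y) ≟F a ⟧)               ≡⟨ ∑-cong elements same-fibre ⟩
    ∑ elements (λ a → ∑ pts λ x → f x * ⟦ (x · y) ≟F g ⟧)               ≡⟨ ∑-const elements _ ⟩
    length elements * ∑ pts (λ x → f x * ⟦ (x · y) ≟F g ⟧)              ≡⟨ cong (_* ∑ pts (λ x → f x * ⟦ (x · y) ≟F g ⟧)) length-elements ⟩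
    q * ∑ pts (λ x → f x * ⟦ (x · y) ≟F g ⟧)                            ∎)
    where
    open ≡-Reasoning
    pts = points d
    split : ∀ x → f x ≡ ∑ elements (λ a → f x * ⟦ (x · y) ≟F a ⟧)
    split x = sym (trans (∑-*ˡ elements (f x) _)
      (trans (cong (f x *_) (trans (∑-cong elements λ a → ⟦⟧-cong ((x · y) ≟F a) (a ≟F (x · y)) sym sym)
                                   (elements-Exhaustive (x · y))))
             (*-identityʳ (f x))))
    same-fibre : ∀ a → ∑ pts (λ x → f x * ⟦ (x · y) ≟F a ⟧) ≡ ∑ pts (λ x → f x * ⟦ (x · y) ≟F g ⟧)
    same-fibre a = trans
      (sym (Mult.∑-reindex pts (points-Exhaustive d) (_⊕ (t • e)) (_⊕ ((⊟ t) • e))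
             (λ x → ⊕-•-inverse (⊟ t) t x e (⊟-inverseˡ t))
             (λ x → ⊕-•-inverse t (⊟ t) x e (⊟-inverseʳ t)) _))
      (∑-cong pts λ x → cong₂ _*_ (f-invariant t x)
         (⟦⟧-cong _ _ (λ eq → ∙-cancelʳ t _ g (trans (sym (shift x)) (trans eq a≡g+t)))
                      (λ eq → trans (shift x) (trans (cong (_⊞ t) eq) (sym a≡g+t)))))
      where
      -- Since `e · y` is 1, adding `t • e` raises `x · y` by `t`, so this `t` carries the fibre
      -- over `g` onto the fibre over `a`.
      t = a ⊞ ⊟ g
      a≡g+t : a ≡ g ⊞ t
      a≡g+t = sym (trans (⊞-comm g t) (⊞-⊟-cancelʳ a g))
      shift : ∀ x → (x ⊕ (t • e)) · y ≡ (x · y) ⊞ t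
      shift x = trans (dot-⊕ˡ x (t • e) y)
        (cong ((x · y) ⊞_) (trans (dot-•ˡ t e y) (trans (cong (t ⊠_) ey≡1) (⊠-identityʳ t))))

-- From 4 (n - D)² ≥ n² when 2 D < n, and (n - D)² ≥ 0 otherwise.
chebyshev : ∀ n D → 8 * n * D + ⟦ 2 * D <? n ⟧ * (n * n) ≤ 4 * (D * D) + 4 * (n * n)
chebyshev n D with 2 * D <? n
-- In every case a gap `r` replaces the difference of the compared numbers. The two sides then
-- differ by a polynomial with non-negative coefficients, so nothing has to be subtracted.
... | yes 2D<n with r , refl ← m≤n⇒∃[o]m+o≡n (<⇒≤ 2D<n) =
      ≤-trans (m≤m+n _ (4 * (D * r) + 3 * (r * r))) (≤-reflexive (expand D r))
  where
  expand : ∀ D r → 8 * (2 * D + r) * D + 1 * ((2 * D + r) * (2 * D + r)) + (4 * (D * r) + 3 * (r * r))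
                   ≡ 4 * (D * D) + 4 * ((2 * D + r) * (2 * D + r))
  expand = solve-∀
... | no _ rewrite +-identityʳ (8 * n * D) with ≤-total n D
...   | inj₁ n≤D with r , refl ← m≤n⇒∃[o]m+o≡n n≤D =
        ≤-trans (m≤m+n _ (4 * (r * r))) (≤-reflexive (expand n r))
  where
  expand : ∀ n r → 8 * n * (n + r) + 4 * (r * r) ≡ 4 * ((n + r) * (n + r)) + 4 * (n * n)
  expand = solve-∀
...   | inj₂ D≤n with r , refl ← m≤n⇒∃[o]m+o≡n D≤n =
        ≤-trans (m≤m+n _ (4 * (r * r))) (≤-reflexive (expand D r))
  where
  expand : ∀ D r → 8 * (D + r) * D + 4 * (r * r) ≡ 4 * (D * D) + 4 * ((D + r) * (D + r))
  expand = solve-∀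

-- The second moment of the hyperplane degrees.

module Variance (𝔽 : FiniteField) {d : ℕ} (lam : FiniteField.Carrier 𝔽)
                (lam≢0 : lam ≢ FiniteField.0# 𝔽) where
  open FiniteField 𝔽 using (Carrier; 0#; 1#; inverse)
    renaming (_+_ to infixl 6 _⊞_; _*_ to infixl 7 _⊠_; -_ to infix 8 ⊟_; size to q)
  open Geometry 𝔽
  open import Algebra.Properties.Group
    (CommutativeRing.+-group F) using (∙-cancelʳ; identityˡ-unique)

  private
    pts : List (Pt d)
    pts = points d

  on : Carrier → Pt d → Pt d → ℕ
  on g x y = ⟦ (x · y) ≟F g ⟧

  deg : Carrier → List (Pt d) → Pt d → ℕ
  deg g L x = ∑ L (on g x)

  ∑-1 : ∑ pts (λ _ → 1) ≡ q ^ d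
  ∑-1 = trans (∑-const pts 1) (trans (*-identityʳ _) (length-points d))

  hyperplane-size : ∀ {w e : Pt d} → e · w ≡ 1# → ∀ g → q * ∑ pts (λ x → on g x w) ≡ q ^ d
  hyperplane-size {w} {e} ew≡1 g = trans
    (cong (q *_) (∑-cong pts λ x → sym (*-identityˡ (on g x w))))
    (trans (∑-hyperplane e w (λ _ → 1) ew≡1 (λ _ _ → refl) g) ∑-1)

  -- With w the component of y' orthogonal to y, either w ≠ 0 and the two
  -- hyperplanes meet in q ^ (d - 2) points, or y' = ± y.
  codegree : ∀ {y y'} → InSphere lam y → InSphere lam y' → ∀ g →
             q * (q * ∑ pts (λ x → on g x y * on g x y'))
               ≤ q ^ d + (⟦ y' ≟ y ⟧ + ⟦ y' ≟ ((⊟ 1#) • y) ⟧) * (q * q ^ d)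
  codegree {y} {y'} y∈S y'∈S g with l⁻¹ , ll⁻¹ ← inverse lam lam≢0 = split (w ≟ zeroV)
    where
    -- As |y|² = `lam`, the vector `c • y` is the orthogonal projection of `y'` onto `y`. On the
    -- hyperplane `x · y` = `g` the condition `x · y'` = `g` becomes `x · w` = `h`.
    c = l⁻¹ ⊠ (y' · y)
    w = y' ⊖ (c • y)
    e = l⁻¹ • y
    h = g ⊞ ⊟ (c ⊠ g)

    l⁻¹l : l⁻¹ ⊠ lam ≡ 1#
    l⁻¹l = trans (⊠-comm l⁻¹ lam) ll⁻¹

    ey≡1 : e · y ≡ 1#
    ey≡1 = trans (dot-•ˡ l⁻¹ y y) (trans (cong (l⁻¹ ⊠_) y∈S) l⁻¹l)

    dot-y' : ∀ x → x · y' ≡ (x · w) ⊞ c ⊠ (x · y)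
    dot-y' x = trans (cong (x ·_) (sym (⊖-⊕-cancel y' (c • y))))
      (trans (dot-⊕ʳ x w (c • y)) (cong ((x · w) ⊞_) (dot-•ʳ c x y)))

    c⊠lam : c ⊠ lam ≡ y · y'
    c⊠lam = begin
      l⁻¹ ⊠ (y' · y) ⊠ lam    ≡⟨ cong (_⊠ lam) (⊠-comm l⁻¹ (y' · y)) ⟩
      (y' · y) ⊠ l⁻¹ ⊠ lam    ≡⟨ ⊠-assoc (y' · y) l⁻¹ lam ⟩
      (y' · y) ⊠ (l⁻¹ ⊠ lam)  ≡⟨ cong ((y' · y) ⊠_) l⁻¹l ⟩
      (y' · y) ⊠ 1#           ≡⟨ ⊠-identityʳ _ ⟩
      y' · y                  ≡⟨ dot-comm y' y ⟩
      y · y'                  ∎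
      where open ≡-Reasoning

    yw≡0 : y · w ≡ 0#
    yw≡0 = identityˡ-unique _ _ (begin
      (y · w) ⊞ (y · y')        ≡⟨ cong ((y · w) ⊞_) c⊠lam ⟨
      (y · w) ⊞ c ⊠ lam         ≡⟨ cong (λ z → (y · w) ⊞ c ⊠ z) y∈S ⟨
      (y · w) ⊞ c ⊠ (y · y)     ≡⟨ dot-y' y ⟨
      y · y'                    ∎)
      where open ≡-Reasoning

    split : Dec (w ≡ zeroV) → _
    -- Slice by `x · y` = `g` with the indicator of `x · w` = `h` as weight; translations along `e`
    -- preserve it because `y · w` is 0. Then count the hyperplane of `w`. Each of the two steps
    -- absorbs one factor `q`.
    split (no w≢0) with f , fw≡1 ← dual w w≢0 = ≤-trans (≤-reflexive (begin
        q * (q * ∑ pts (λ x → on g x y * on g x y'))  ≡⟨ cong (λ z → q * (q * z)) (∑-cong pts swap) ⟩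
        q * (q * ∑ pts (λ x → on h x w * on g x y))   ≡⟨ cong (q *_) (∑-hyperplane e y (λ x → on h x w) ey≡1 invariant g) ⟩
        q * ∑ pts (λ x → on h x w)                    ≡⟨ hyperplane-size {e = f} fw≡1 h ⟩
        q ^ d                                         ∎)) (m≤m+n _ _)
      where
      open ≡-Reasoning
      swap : ∀ x → on g x y * on g x y' ≡ on h x w * on g x y
      swap x with (x · y) ≟F g
      ... | no  _    = sym (*-zeroʳ (on h x w))
      ... | yes xy≡g = trans (*-identityˡ _) (trans (⟦⟧-cong ((x · y') ≟F g) ((x · w) ≟F h)
            (λ eq → ∙-cancelʳ (c ⊠ g) _ _ (trans (sym xy'≡) (trans eq (sym (⊞-⊟-cancelʳ g _)))))
            (λ eq → trans xy'≡ (trans (cong (_⊞ c ⊠ g) eq) (⊞-⊟-cancelʳ g _)))) (sym (*-identityʳ _)))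
        where
        xy'≡ : x · y' ≡ (x · w) ⊞ c ⊠ g
        xy'≡ = trans (dot-y' x) (cong (λ z → (x · w) ⊞ c ⊠ z) xy≡g)
      invariant : ∀ t x → on h (x ⊕ (t • e)) w ≡ on h x w
      invariant t x = cong (λ z → ⟦ z ≟F h ⟧) (begin
        (x ⊕ (t • e)) · w                    ≡⟨ dot-⊕ˡ x (t • e) w ⟩
        (x · w) ⊞ ((t • e) · w)              ≡⟨ cong ((x · w) ⊞_) (dot-•ˡ t e w) ⟩
        (x · w) ⊞ t ⊠ (e · w)                ≡⟨ cong (λ z → (x · w) ⊞ t ⊠ z) (dot-•ˡ l⁻¹ y w) ⟩
        (x · w) ⊞ t ⊠ (l⁻¹ ⊠ (y · w))        ≡⟨ cong (λ z → (x · w) ⊞ t ⊠ (l⁻¹ ⊠ z)) yw≡0 ⟩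
        (x · w) ⊞ t ⊠ (l⁻¹ ⊠ 0#)             ≡⟨ cong (λ z → (x · w) ⊞ t ⊠ z) (⊠-zeroʳ l⁻¹) ⟩
        (x · w) ⊞ t ⊠ 0#                     ≡⟨ cong ((x · w) ⊞_) (⊠-zeroʳ t) ⟩
        (x · w) ⊞ 0#                         ≡⟨ ⊞-identityʳ _ ⟩
        x · w                                ∎)
    -- Now `y'` is a multiple of `y`. Only one hyperplane condition is kept, and the surplus factor
    -- `q` is paid for by the indicators of `y'` = ± `y`.
    split (yes w≡0) = begin
        q * (q * ∑ pts (λ x → on g x y * on g x y'))  ≤⟨ *-monoʳ-≤ q (*-monoʳ-≤ q (∑-mono pts λ {x} _ →
                                                          ≤-trans (*-monoʳ-≤ (on g x y) (⟦⟧-≤1 ((x · y') ≟F g))) (≤-reflexive (*-identityʳ _)))) ⟩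
        q * (q * ∑ pts (λ x → on g x y))              ≡⟨ cong (q *_) (hyperplane-size {e = e} ey≡1 g) ⟩
        q * q ^ d                                     ≡⟨ *-identityˡ _ ⟨
        1 * (q * q ^ d)                               ≤⟨ *-monoˡ-≤ (q * q ^ d) parallel ⟩
        (⟦ y' ≟ y ⟧ + ⟦ y' ≟ ((⊟ 1#) • y) ⟧) * (q * q ^ d)  ≤⟨ m≤n+m _ (q ^ d) ⟩
        q ^ d + (⟦ y' ≟ y ⟧ + ⟦ y' ≟ ((⊟ 1#) • y) ⟧) * (q * q ^ d) ∎
      where
      open ≤-Reasoning
      y'≡cy : y' ≡ c • y
      y'≡cy = trans (sym (⊖-⊕-cancel y' (c • y))) (trans (cong (_⊕ (c • y)) w≡0) (zeroV-⊕ (c • y)))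
      c²≡1 : c ⊠ c ≡ 1#
      -- c² `lam` = c (`y · y'`) = `(c • y) · y'` = |y'|² = `lam`.
      c²≡1 = ⊠-cancelˡ (c ⊠ c) 1# lam≢0 (trans (⊠-comm lam (c ⊠ c)) (trans (⊠-assoc c c lam)
               (trans (cong (c ⊠_) c⊠lam) (trans (sym (dot-•ˡ c y y')) (trans (cong (_· y') (sym y'≡cy))
               (trans y'∈S (sym (⊠-identityʳ lam))))))))
      parallel : 1 ≤ ⟦ y' ≟ y ⟧ + ⟦ y' ≟ ((⊟ 1#) • y) ⟧
      parallel with square-one c c²≡1
      ... | inj₁ c≡1  = ≤-trans (≤-reflexive (sym (⟦⟧-yes (y' ≟ y)
                          (trans y'≡cy (trans (cong (_• y) c≡1) (1•-identity y)))))) (m≤m+n _ _)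
      ... | inj₂ c≡-1 = ≤-trans (≤-reflexive (sym (⟦⟧-yes (y' ≟ ((⊟ 1#) • y))
                          (trans y'≡cy (cong (_• y) c≡-1))))) (m≤n+m _ _)

  module _ (g : Carrier) {L : List (Pt d)} (L! : Unique L) (L⊆S : All (InSphere lam) L) where

    private
      n = length L
      -- Scaling by `q` makes the mean equal to `n`, so that no division occurs.
      D : Pt d → ℕ
      D x = q * deg g L x

    -- Exchange the sums: each `y` in `L` contributes the points of one hyperplane. The multiple of
    -- `y` by the inverse of `lam` witnesses that `x ↦ x · y` takes each value equally often.
    ∑-degree : ∑ pts D ≡ n * q ^ d
    ∑-degree = begin
      ∑ pts (λ x → q * deg g L x)             ≡⟨ ∑-*ˡ pts q _ ⟩
      q * ∑ pts (λ x → ∑ L (on g x))          ≡⟨ cong (q *_) (∑-swap pts L (on g)) ⟩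
      q * ∑ L (λ y → ∑ pts λ x → on g x y)    ≡⟨ ∑-*ˡ L q _ ⟨
      ∑ L (λ y → q * ∑ pts λ x → on g x y)    ≡⟨ ∑-cong-∈ ⟩
      ∑ L (λ _ → q ^ d)                       ≡⟨ ∑-const L (q ^ d) ⟩
      n * q ^ d                               ∎
      where
      open ≡-Reasoning
      size : ∀ {y} → y ∈ L → q * ∑ pts (λ x → on g x y) ≡ q ^ d
      size {y} y∈L with c , lc≡1 ← inverse lam lam≢0 = hyperplane-size {e = c • y}
        (trans (dot-•ˡ c y y) (trans (cong (c ⊠_) (All.lookup L⊆S y∈L)) (trans (⊠-comm c lam) lc≡1))) g
      ∑-cong-∈ : ∑ L (λ y → q * ∑ pts λ x → on g x y) ≡ ∑ L (λ _ → q ^ d)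
      ∑-cong-∈ = ≤-antisym (∑-mono L λ y∈L → ≤-reflexive (size y∈L))
                           (∑-mono L λ y∈L → ≤-reflexive (sym (size y∈L)))

    -- Expand the square over pairs and apply `codegree`. For a fixed `y` at most one `y'` in `L` is
    -- `y` and at most one is its negative, since `L` has no repetitions; hence the 2.
    ∑-degree² : ∑ pts (λ x → D x * D x) ≤ n * (n * q ^ d + 2 * (q * q ^ d))
    ∑-degree² = begin
      ∑ pts (λ x → D x * D x)                     ≡⟨ ∑-cong pts expand ⟩
      ∑ pts (λ x → ∑ L λ y → ∑ L λ y' → q * (q * (on g x y * on g x y')))
                                                  ≡⟨ ∑-swap pts L _ ⟩
      ∑ L (λ y → ∑ pts λ x → ∑ L λ y' → q * (q * (on g x y * on g x y')))
                                                  ≤⟨ ∑-mono L row ⟩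
      ∑ L (λ _ → n * q ^ d + 2 * (q * q ^ d))     ≡⟨ ∑-const L _ ⟩
      n * (n * q ^ d + 2 * (q * q ^ d))           ∎
      where
      open ≤-Reasoning
      regroup : ∀ q a b → q * a * (q * b) ≡ q * (q * (a * b))
      regroup = solve-∀
      expand : ∀ x → D x * D x ≡ ∑ L λ y → ∑ L λ y' → q * (q * (on g x y * on g x y'))
      expand x = trans (regroup q (deg g L x) (deg g L x)) (sym (trans
        (∑-cong L λ y → trans (∑-*ˡ L q _) (cong (q *_) (trans (∑-*ˡ L q _) (cong (q *_) (∑-*ˡ L (on g x y) (on g x))))))
        (trans (∑-*ˡ L q _) (cong (q *_) (trans (∑-*ˡ L q _) (cong (q *_) (∑-*ʳ L (deg g L x) (on g x))))))))
      row : ∀ {y} → y ∈ L → ∑ pts (λ x → ∑ L λ y' → q * (q * (on g x y * on g x y')))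
                              ≤ n * q ^ d + 2 * (q * q ^ d)
      row {y} y∈L = begin
        ∑ pts (λ x → ∑ L λ y' → q * (q * (on g x y * on g x y')))  ≡⟨ ∑-swap pts L _ ⟩
        ∑ L (λ y' → ∑ pts λ x → q * (q * (on g x y * on g x y')))
          ≡⟨ ∑-cong L (λ y' → trans (∑-*ˡ pts q _) (cong (q *_) (∑-*ˡ pts q _))) ⟩
        ∑ L (λ y' → q * (q * ∑ pts λ x → on g x y * on g x y'))
          ≤⟨ ∑-mono L (λ y'∈L → codegree (All.lookup L⊆S y∈L) (All.lookup L⊆S y'∈L) g) ⟩
        ∑ L (λ y' → q ^ d + (⟦ y' ≟ y ⟧ + ⟦ y' ≟ ((⊟ 1#) • y) ⟧) * (q * q ^ d))
          ≡⟨ ∑-+ L (λ _ → q ^ d) _ ⟩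
        ∑ L (λ _ → q ^ d) + ∑ L (λ y' → (⟦ y' ≟ y ⟧ + ⟦ y' ≟ ((⊟ 1#) • y) ⟧) * (q * q ^ d))
          ≡⟨ cong₂ _+_ (∑-const L (q ^ d)) (trans (∑-*ʳ L (q * q ^ d) _) (cong (_* (q * q ^ d)) (∑-+ L _ _))) ⟩
        n * q ^ d + (Mult.mult y L + Mult.mult ((⊟ 1#) • y) L) * (q * q ^ d)
          ≤⟨ +-monoʳ-≤ (n * q ^ d) (*-monoˡ-≤ (q * q ^ d)
               (+-mono-≤ (Mult.Unique⇒mult≤1 y L!) (Mult.Unique⇒mult≤1 ((⊟ 1#) • y) L!))) ⟩
        n * q ^ d + 2 * (q * q ^ d) ∎

    -- Sum `chebyshev` over all points and insert both moments. The terms 8 n² q^d on the two sides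
    -- cancel exactly, and one factor n is then divided out.
    poor-count : ∑ pts (λ x → ⟦ 2 * D x <? n ⟧) * n ≤ 8 * (q * q ^ d)
    poor-count = cancel n (+-cancelˡ-≤ (8 * n * (n * q ^ d)) _ _ (begin
      8 * n * (n * q ^ d) + B * (n * n)
        ≡⟨ cong₂ (λ a b → 8 * n * a + b) (sym ∑-degree) (sym (∑-*ʳ pts (n * n) _)) ⟩
      8 * n * ∑ pts D + ∑ pts (λ x → ⟦ 2 * D x <? n ⟧ * (n * n))
        ≡⟨ cong (_+ ∑ pts (λ x → ⟦ 2 * D x <? n ⟧ * (n * n))) (∑-*ˡ pts (8 * n) D) ⟨
      ∑ pts (λ x → 8 * n * D x) + ∑ pts (λ x → ⟦ 2 * D x <? n ⟧ * (n * n))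
        ≡⟨ ∑-+ pts _ _ ⟨
      ∑ pts (λ x → 8 * n * D x + ⟦ 2 * D x <? n ⟧ * (n * n))
        ≤⟨ ∑-mono pts (λ {x} _ → chebyshev n (D x)) ⟩
      ∑ pts (λ x → 4 * (D x * D x) + 4 * (n * n))
        ≡⟨ trans (∑-+ pts _ _) (cong₂ _+_ (∑-*ˡ pts 4 _) (trans (∑-const pts _) (cong (_* (4 * (n * n))) (length-points d)))) ⟩
      4 * ∑ pts (λ x → D x * D x) + q ^ d * (4 * (n * n))
        ≤⟨ +-monoˡ-≤ (q ^ d * (4 * (n * n))) (*-monoʳ-≤ 4 ∑-degree²) ⟩
      4 * (n * (n * q ^ d + 2 * (q * q ^ d))) + q ^ d * (4 * (n * n))
        ≡⟨ regroup n q (q ^ d) ⟩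
      8 * n * (n * q ^ d) + n * (8 * (q * q ^ d)) ∎))
      where
      open ≤-Reasoning
      B = ∑ pts (λ x → ⟦ 2 * D x <? n ⟧)
      regroup : ∀ n q r → 4 * (n * (n * r + 2 * (q * r))) + r * (4 * (n * n)) ≡ 8 * n * (n * r) + n * (8 * (q * r))
      regroup = solve-∀
      cancel : ∀ n → B * (n * n) ≤ n * (8 * (q * q ^ d)) → B * n ≤ 8 * (q * q ^ d)
      -- For an empty `L` the factor cannot be cancelled, but the left side is 0.
      cancel zero      _  = ≤-trans (≤-reflexive (*-zeroʳ B)) z≤n
      cancel n@(suc _) le = *-cancelˡ-≤ n (≤-trans (≤-reflexive (swap n B)) le)
        where
        swap : ∀ n B → n * (B * n) ≡ B * (n * n)
        swap = solve-∀

-- Lists of distinct tuples and disjoint blocks.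

Distinct : ∀ {m} {S : Set} → List (Fin m → S) → Set
Distinct = AllPairs λ y y' → ¬ (∀ i → y i ≡ y' i)

-- The clause on `y zero` strengthens the induction: tuples starting with `x` differ from all later
-- ones, whose first entries lie in a list avoiding `x`.
prepend : ∀ {m N} {S : Set} {P : (Fin (suc m) → S) → Set} (xs : List S) → Unique xs →
          (∀ {x} → x ∈ xs → ∃ λ zs → Distinct zs × All (λ z → P (x Vector.∷ z)) zs × N ≤ length zs) →
          ∃ λ ys → Distinct ys × All P ys × All (λ y → y zero ∈ xs) ys × length xs * N ≤ length ys
prepend [] _ _ = [] , [] , [] , [] , z≤n
prepend {N = N} (x ∷ xs) (x∉xs ∷ xs!) extend
  with zs , zs! , Pzs , N≤ ← extend (here refl)
     | ys , ys! , Pys , ys∈ , N*≤ ← prepend xs xs! (λ x∈ → extend (there x∈)) =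
  map (x Vector.∷_) zs ++ ys ,
  AllPairs.++⁺ (AllPairs.map⁺ (AllPairs.map (λ z≢z' same → z≢z' λ i → same (suc i)) zs!)) ys!
    (All.map⁺ (All.universal (λ _ → All.map (λ y∈ same → All.lookup x∉xs y∈ (same zero)) ys∈) zs)) ,
  All.++⁺ (All.map⁺ Pzs) Pys ,
  All.++⁺ (All.map⁺ (All.universal (λ _ → here refl) zs)) (All.map there ys∈) ,
  ≤-trans (+-mono-≤ N≤ N*≤) (≤-reflexive (trans (cong (_+ length ys) (sym (length-map _ zs)))
                                                (sym (length-++ (map (x Vector.∷_) zs)))))

-- Serves to pass from distinct tuples to different vertex sets, which requires knowing that both
-- tuples run through the disjoint blocks.
AllPairs-map-All : ∀ {S : Set} {P : S → Set} {R T : S → S → Set} {xs} →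
                   (∀ {x y} → P x → P y → R x y → T x y) → All P xs → AllPairs R xs → AllPairs T xs
AllPairs-map-All f []         []         = []
AllPairs-map-All f (px ∷ pxs) (rx ∷ rxs) =
  All.zipWith (λ { (py , r) → f px py r }) (pxs , rx) ∷ AllPairs-map-All f pxs rxs

take-drop-disjoint : ∀ {S : Set} n {xs : List S} → Unique xs → ∀ {x} → x ∈ take n xs → ¬ x ∈ drop n xs
take-drop-disjoint (suc n) (x∉xs ∷ xs!) (here refl) x∈ =
  contradiction refl (All.lookup (All.drop⁺ n x∉xs) x∈)
take-drop-disjoint (suc n) (_ ∷ xs!)    (there x∈ˡ) x∈ = take-drop-disjoint n xs! x∈ˡ x∈

-- Cut off `s` entries `m` times and discard the rest. Disjointness is phrased as equality of
-- indices because it is applied to identify the positions of a common vertex.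
partition : ∀ {S : Set} m s (xs : List S) → m * s ≤ length xs → Unique xs →
            ∃ λ (L : Fin m → List S) → (∀ i → Unique (L i)) × (∀ i {x} → x ∈ L i → x ∈ xs) ×
              (∀ i → s ≤ length (L i)) × (∀ {i j x} → x ∈ L i → x ∈ L j → i ≡ j)
partition zero    s xs _  _   = (λ ()) , (λ ()) , (λ ()) , (λ ()) , λ { {()} }
partition {S} (suc m) s xs le xs!
  with L , L! , L⊆ , s≤ , disjoint ← partition m s (drop s xs)
         (subst (m * s ≤_) (sym (length-drop s xs))
           (m+n≤o⇒m≤o∸n (m * s) (subst (_≤ length xs) (+-comm s (m * s)) le)))
         (Unique.drop⁺ s xs!) = L' , L'! , L'⊆ , s≤' , disjoint'
  where
  L' : Fin (suc m) → List S
  L' = take s xs Vector.∷ L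
  L'! : ∀ i → Unique (L' i)
  L'! zero    = Unique.take⁺ s xs!
  L'! (suc i) = L! i
  L'⊆ : ∀ i {x} → x ∈ L' i → x ∈ xs
  L'⊆ zero    x∈ = subst (_ ∈_) (take++drop≡id s xs) (∈-++⁺ˡ x∈)
  L'⊆ (suc i) x∈ = subst (_ ∈_) (take++drop≡id s xs) (∈-++⁺ʳ (take s xs) (L⊆ i x∈))
  s≤' : ∀ i → s ≤ length (L' i)
  s≤' zero    = ≤-reflexive (sym (trans (length-take s xs) (m≤n⇒m⊓n≡m (m+n≤o⇒m≤o s le))))
  s≤' (suc i) = s≤ i
  disjoint' : ∀ {i j x} → x ∈ L' i → x ∈ L' j → i ≡ j
  disjoint' {zero}  {zero}  _  _  = refl
  disjoint' {zero}  {suc j} x∈ x∈' = contradiction (L⊆ j x∈') (take-drop-disjoint s xs! x∈)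
  disjoint' {suc i} {zero}  x∈ x∈' = contradiction (L⊆ i x∈) (take-drop-disjoint s xs! x∈')
  disjoint' {suc i} {suc j} x∈ x∈' = cong suc (disjoint x∈ x∈')

-- Arithmetic of the exponents.

n≤2^n : ∀ n → n ≤ 2 ^ n
n≤2^n zero    = z≤n
n≤2^n (suc n) = +-mono-≤ (m^n>0 2 n) (≤-trans (n≤2^n n) (m≤m+n _ 0))

-- The sum of the `m` terms e, e - 1, e - 2, ..., truncated at 0: each chosen vertex costs the later
-- ones a factor `q`.
copyExponent : ℕ → ℕ → ℕ
copyExponent zero    e = 0
copyExponent (suc m) e = e + copyExponent m (pred e)

-- The binomial coefficient m over 2.
triangular : ℕ → ℕ
triangular zero    = 0
triangular (suc m) = m + triangular m

triangular-double : ∀ m → triangular (suc m) * 2 ≡ m * suc m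
triangular-double zero    = refl
triangular-double (suc m) = trans (*-distribʳ-+ 2 (suc m) (triangular (suc m)))
  (trans (cong (suc m * 2 +_) (triangular-double m)) (identity m))
  where
  identity : ∀ m → suc m * 2 + m * suc m ≡ suc m * suc (suc m)
  identity = solve-∀

-- The term with index i of `copyExponent` falls short of `e` by at most i, and these defects add up
-- to `triangular m`.
m*e≤triangular+copyExponent : ∀ m e → m * e ≤ triangular m + copyExponent m e
m*e≤triangular+copyExponent zero    e = z≤n
m*e≤triangular+copyExponent (suc m) e = begin
  e + m * e                                               ≤⟨ +-monoʳ-≤ e (*-monoʳ-≤ m (≤suc-pred e)) ⟩
  e + m * suc (pred e)                                    ≡⟨ cong (e +_) (*-suc m (pred e)) ⟩
  e + (m + m * pred e)                                    ≤⟨ +-monoʳ-≤ e (+-monoʳ-≤ m (m*e≤triangular+copyExponent m (pred e))) ⟩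
  e + (m + (triangular m + copyExponent m (pred e)))      ≡⟨ regroup e m (triangular m) _ ⟩
  m + triangular m + (e + copyExponent m (pred e))        ∎
  where
  open ≤-Reasoning
  ≤suc-pred : ∀ e → e ≤ suc (pred e)
  ≤suc-pred zero    = z≤n
  ≤suc-pred (suc e) = ≤-refl
  regroup : ∀ e m t c → e + (m + (t + c)) ≡ m + t + (e + c)
  regroup = solve-∀

-- Greedy construction of tuples with prescribed dot products.

module Embedding (𝔽 : FiniteField) {d : ℕ} (lam : FiniteField.Carrier 𝔽)
                 (lam≢0 : lam ≢ FiniteField.0# 𝔽)
                 (1≤d : 1 ≤ d) (4≤q : 4 ≤ FiniteField.size 𝔽) where
  open FiniteField 𝔽 using (Carrier) renaming (size to q)
  open Geometry 𝔽
  open Variance 𝔽 {d} lam lam≢0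

  instance
    q≢0 : NonZero q
    q≢0 = >-nonZero (≤-trans (s≤s z≤n) 4≤q)

  -- The union bound over `m` target lists, against the square of the list size s = 2^(m+1) q^(e+1).
  -- Of the constant 16, one 4 is absorbed by `q` and the other by the powers of 2, while m ≤ 2^m;
  -- what remains is d + 2 ≤ 2 (e + 1).
  poor-bound : ∀ m e → d + 2 * suc m ≤ 2 + 2 * suc e →
             2 * (m * (8 * (q * q ^ d))) ≤ 2 ^ suc m * q ^ suc e * (2 ^ suc m * q ^ suc e)
  -- A separate case: for m = 0 the hypothesis only gives d ≤ 2 (e + 1), but there are no poor
  -- points to count.
  poor-bound zero      e _  = z≤n
  poor-bound m@(suc m') e le = begin
    2 * (m * (8 * (q * q ^ d)))                               ≡⟨ regroup₁ m q (q ^ d) ⟩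
    4 * (4 * (m * 1) * (q * q ^ d))                           ≤⟨ *-monoʳ-≤ 4 (*-monoˡ-≤ (q * q ^ d) (*-mono-≤ 4≤q (*-mono-≤ (n≤2^n m) (m^n>0 2 m)))) ⟩
    4 * (q * (2 ^ m * 2 ^ m) * (q * q ^ d))                   ≡⟨ regroup₂ q (2 ^ m) (q ^ d) ⟩
    2 ^ suc m * 2 ^ suc m * q ^ (2 + d)                       ≤⟨ *-monoʳ-≤ (2 ^ suc m * 2 ^ suc m) (^-monoʳ-≤ q exponents) ⟩
    2 ^ suc m * 2 ^ suc m * q ^ (suc e + suc e)               ≡⟨ cong (2 ^ suc m * 2 ^ suc m *_) (^-distribˡ-+-* q (suc e) (suc e)) ⟩
    2 ^ suc m * 2 ^ suc m * (q ^ suc e * q ^ suc e)           ≡⟨ regroup₃ (2 ^ suc m) (q ^ suc e) ⟩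
    2 ^ suc m * q ^ suc e * (2 ^ suc m * q ^ suc e)           ∎
    where
    open ≤-Reasoning
    regroup₁ : ∀ m q r → 2 * (m * (8 * (q * r))) ≡ 4 * (4 * (m * 1) * (q * r))
    regroup₁ = solve-∀
    regroup₂ : ∀ q t r → 4 * (q * (t * t) * (q * r)) ≡ 2 * t * (2 * t) * (q * (q * r))
    regroup₂ = solve-∀
    regroup₃ : ∀ t r → t * t * (r * r) ≡ t * r * (t * r)
    regroup₃ = solve-∀
    regroup₄ : ∀ d m → 2 + (2 + d) + 2 * m ≡ d + 2 * suc (suc m)
    regroup₄ = solve-∀
    double : ∀ e → 2 * suc e ≡ suc e + suc e
    double = solve-∀
    exponents : 2 + d ≤ suc e + suc e
    exponents = subst (2 + d ≤_) (double e) (+-cancelˡ-≤ 2 _ _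
      (≤-trans (m≤m+n _ (2 * m')) (≤-trans (≤-reflexive (regroup₄ d m')) le)))

  -- The mean of deg (g j) (L j) over all x is length (L j) / q.
  module _ {m} (g : Fin m → Carrier) (L : Fin m → List (Pt d)) where

    Rich : Pt d → Set
    Rich x = ∀ j → length (L j) ≤ 2 * (q * deg (g j) (L j) x)

    rich? : ∀ x → Dec (Rich x)
    rich? x = Fin.all? λ j → length (L j) ≤? 2 * (q * deg (g j) (L j) x)

    -- Points that are poor for some target number at most s / 2 in the whole space, so at least s /
    -- 2 of the s or more points of `K` are rich for all targets simultaneously.
    rich-count : ∀ e → d + 2 * suc m ≤ 2 + 2 * suc e →
                 (∀ j → Unique (L j)) → (∀ j → All (InSphere lam) (L j)) →
                 (∀ j → 2 ^ suc m * q ^ suc e ≤ length (L j)) →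
                 ∀ {K} → Unique K → 2 ^ suc m * q ^ suc e ≤ length K →
                 2 ^ m * q ^ suc e ≤ length (filter rich? K)
    rich-count e dim L! L⊆S s≤ {K} K! s≤K =
      *-cancelˡ-≤ 2 (+-cancelʳ-≤ s _ _ (begin
        2 * (2 ^ m * q ^ suc e) + s       ≡⟨ cong (_+ s) (*-assoc 2 (2 ^ m) (q ^ suc e)) ⟨
        s + s                             ≤⟨ +-mono-≤ cover cover ⟩
        (R + B) + (R + B)                 ≡⟨ regroup R B ⟩
        2 * R + 2 * B                     ≤⟨ +-monoʳ-≤ (2 * R) 2B≤s ⟩
        2 * R + s                         ∎))
      where
      open ≤-Reasoning
      s = 2 ^ suc m * q ^ suc e
      R = length (filter rich? K)
      poor : Fin m → Pt d → ℕ
      poor j x = ⟦ 2 * (q * deg (g j) (L j) x) <? length (L j) ⟧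
      B = ∑ (allFin m) λ j → ∑ (points d) (poor j)
      regroup : ∀ R B → (R + B) + (R + B) ≡ 2 * R + 2 * B
      regroup = solve-∀
      instance
        s≢0 : NonZero s
        s≢0 = m*n≢0 (2 ^ suc m) (q ^ suc e) {{m^n≢0 2 (suc m)}} {{m^n≢0 q (suc e)}}
      rich-or-poor : ∀ x → 1 ≤ ⟦ rich? x ⟧ + ∑ (allFin m) (λ j → poor j x)
      rich-or-poor x with rich? x
      ... | yes _ = s≤s z≤n
      ... | no ¬rich with j , ¬rich-j ← Fin.¬∀⟶∃¬ m _ (λ j → length (L j) ≤? 2 * (q * deg (g j) (L j) x)) ¬rich =
            ≤-trans (≤-reflexive (sym (⟦⟧-yes (2 * (q * deg (g j) (L j) x) <? length (L j)) (≰⇒> ¬rich-j))))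
                    (∈⇒≤∑ (λ j → poor j x) (∈-allFin j))
      cover : s ≤ R + B
      cover = begin
        s                                                      ≤⟨ s≤K ⟩
        length K                                               ≡⟨ trans (∑-const K 1) (*-identityʳ _) ⟨
        ∑ K (λ _ → 1)                                          ≤⟨ ∑-mono K (λ {x} _ → rich-or-poor x) ⟩
        ∑ K (λ x → ⟦ rich? x ⟧ + ∑ (allFin m) λ j → poor j x)  ≡⟨ ∑-+ K _ _ ⟩
        ∑ K (λ x → ⟦ rich? x ⟧) + ∑ K (λ x → ∑ (allFin m) λ j → poor j x)
          ≡⟨ cong₂ _+_ (sym (length-filter rich? K)) (∑-swap K (allFin m) _) ⟩
        R + ∑ (allFin m) (λ j → ∑ K (poor j))
          ≤⟨ +-monoʳ-≤ R (∑-mono (allFin m) λ {j} _ → Mult.∑-Unique-≤ (points d) (points-Exhaustive d) K! (poor j)) ⟩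
        R + B                                                  ∎
      -- Multiply by `s`, which is at most the length of every target list, to make `poor-count`
      -- applicable; cancel it at the end.
      2B≤s : 2 * B ≤ s
      2B≤s = *-cancelʳ-≤ (2 * B) s s (begin
        2 * B * s                                               ≡⟨ *-assoc 2 B s ⟩
        2 * (B * s)                                             ≡⟨ cong (2 *_) (∑-*ʳ (allFin m) s _) ⟨
        2 * ∑ (allFin m) (λ j → ∑ (points d) (poor j) * s)      ≤⟨ *-monoʳ-≤ 2 (∑-mono (allFin m) λ {j} _ →
                                                                     ≤-trans (*-monoʳ-≤ (∑ (points d) (poor j)) (s≤ j)) (poor-count (g j) (L! j) (L⊆S j))) ⟩
        2 * ∑ (allFin m) (λ _ → 8 * (q * q ^ d))                ≡⟨ cong (2 *_) (trans (∑-const (allFin m) _) (cong (_* (8 * (q * q ^ d))) (length-tabulate {n = m} (λ i → i)))) ⟩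
        2 * (m * (8 * (q * q ^ d)))                             ≤⟨ poor-bound m e dim ⟩
        s * s                                                   ∎)

  -- Pairs with i < j match the order in which vertices are chosen; symmetry of the dot product
  -- gives the reversed pairs.
  Realises : ∀ {m} → (Fin m → Fin m → Carrier) → (Fin m → List (Pt d)) → (Fin m → Pt d) → Set
  Realises G L y = (∀ i → y i ∈ L i) × (∀ i j → i Fin.< j → y i · y j ≡ G i j)

  -- Choose a rich first vertex and restrict the later lists to its hyperplanes. Losing a factor 2 q
  -- turns 2^(m+1) q^(e+1) into 2^m q^e, and both sides of the dimension condition drop by 2, so the
  -- hypotheses reproduce themselves.
  embed : ∀ m e (G : Fin m → Fin m → Carrier) (L : Fin m → List (Pt d)) →
          (∀ i → Unique (L i)) → (∀ i → All (InSphere lam) (L i)) →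
          (∀ i → 2 ^ m * q ^ e ≤ length (L i)) → d + 2 * m ≤ 2 + 2 * e →
          ∃ λ ys → Distinct ys × All (Realises G L) ys × q ^ copyExponent m e ≤ length ys
  embed zero e G L _ _ _ _ =
    ((λ ()) ∷ []) , ([] ∷ []) , (((λ ()) , (λ ())) ∷ []) , ≤-refl
  -- The exponent cannot run out before the vertices do: the dimension condition would read 3 ≤ 2.
  embed (suc m) zero G L _ _ _ dim = contradiction (≤-trans (+-mono-≤ 1≤d 2≤) dim) λ { (s≤s (s≤s ())) }
    where
    2≤ : 2 ≤ 2 * suc m
    2≤ = *-monoʳ-≤ 2 (s≤s {n = m} z≤n)
  embed (suc m) (suc e) G L L! L⊆S s≤ dim =
    let ys , ys! , P , _ , N≤ = prepend (filter (rich? g L⁺) (L zero))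
                                  (Unique.filter⁺ (rich? g L⁺) (L! zero)) extend
    in ys , ys! , P , (begin
      q ^ (suc e + copyExponent m e)              ≡⟨ ^-distribˡ-+-* q (suc e) (copyExponent m e) ⟩
      q ^ suc e * q ^ copyExponent m e            ≤⟨ *-monoˡ-≤ (q ^ copyExponent m e) enough ⟩
      length (filter (rich? g L⁺) (L zero)) * q ^ copyExponent m e  ≤⟨ N≤ ⟩
      length ys                                   ∎)
    where
    open ≤-Reasoning
    g : Fin m → Carrier
    g j = G zero (suc j)
    L⁺ : Fin m → List (Pt d)
    L⁺ j = L (suc j)
    enough : q ^ suc e ≤ length (filter (rich? g L⁺) (L zero))
    enough = ≤-trans (m≤n*m (q ^ suc e) (2 ^ m) {{m^n≢0 2 m}})
      (rich-count g L⁺ e dim (λ j → L! (suc j)) (λ j → L⊆S (suc j)) (λ j → s≤ (suc j)) (L! zero) (s≤ zero))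
    smaller : d + 2 * m ≤ 2 + 2 * e
    smaller = +-cancelˡ-≤ 2 _ _ (subst₂ _≤_ (regroup d m) (cong (2 +_) (*-suc 2 e)) dim)
      where
      regroup : ∀ d m → d + 2 * suc m ≡ 2 + (d + 2 * m)
      regroup = solve-∀
    extend : ∀ {x} → x ∈ filter (rich? g L⁺) (L zero) →
             ∃ λ zs → Distinct zs × All (λ z → Realises G L (x Vector.∷ z)) zs × q ^ copyExponent m e ≤ length zs
    extend {x} x∈ =
      let zs , zs! , P , N≤ = embed m e (λ i j → G (suc i) (suc j)) L'
                                (λ j → Unique.filter⁺ (on-plane j) (L! (suc j)))
                                (λ j → All.filter⁺ (on-plane j) (L⊆S (suc j)))
                                (λ j → *-cancelˡ-≤ (2 * q) {{m*n≢0 2 q}} (long j)) smaller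
      in zs , zs! , All.map realises P , N≤
      where
      on-plane : ∀ j y → Dec (x · y ≡ g j)
      on-plane j y = (x · y) ≟F g j
      L' : Fin m → List (Pt d)
      L' j = filter (on-plane j) (L⁺ j)
      x-split : x ∈ L zero × Rich g L⁺ x
      x-split = ∈-filter⁻ (rich? g L⁺) {xs = L zero} x∈
      -- Richness of `x` bounds `L⁺ j` by 2 q times its degree, and this degree is the length of
      -- `L' j`.
      long : ∀ j → 2 * q * (2 ^ m * q ^ e) ≤ 2 * q * length (L' j)
      long j = begin
        2 * q * (2 ^ m * q ^ e)              ≡⟨ regroup q (2 ^ m) (q ^ e) ⟩
        2 ^ suc m * q ^ suc e                ≤⟨ s≤ (suc j) ⟩
        length (L⁺ j)                        ≤⟨ proj₂ x-split j ⟩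
        2 * (q * deg (g j) (L⁺ j) x)         ≡⟨ *-assoc 2 q _ ⟨
        2 * q * deg (g j) (L⁺ j) x           ≡⟨ cong (2 * q *_) (length-filter (on-plane j) (L⁺ j)) ⟨
        2 * q * length (L' j) ∎
        where
        regroup : ∀ q t r → 2 * q * (t * r) ≡ 2 * t * (q * r)
        regroup = solve-∀
      realises : ∀ {z} → Realises (λ i j → G (suc i) (suc j)) L' z →
                 Realises G L (x Vector.∷ z)
      realises {z} (z∈ , zz) = member , dots
        where
        split : ∀ j → z j ∈ L⁺ j × x · z j ≡ g j
        split j = ∈-filter⁻ (on-plane j) (z∈ j)
        member : ∀ i → (x Vector.∷ z) i ∈ L i
        member zero    = proj₁ x-split
        member (suc j) = proj₁ (split j)
        dots : ∀ i j → i Fin.< j → (x Vector.∷ z) i · (x Vector.∷ z) j ≡ G i j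
        dots zero    (suc j) _         = proj₂ (split j)
        dots (suc i) (suc j) (s≤s i<j) = zz i j i<j

-- From dot products on a sphere to distances.

module Isometry (𝔽 : FiniteField) {d : ℕ} where
  open FiniteField 𝔽 using (Carrier; 0#)
    renaming (_+_ to infixl 6 _⊞_; -_ to infix 8 ⊟_)
  open Geometry 𝔽
  open import Algebra.Properties.Group
    (CommutativeRing.+-group F) using (∙-cancelʳ; identityˡ-unique)
  open import Algebra.Properties.CommutativeSemigroup
    (CommutativeRing.+-commutativeSemigroup F) using (interchange)

  ∣v⊖v∣² : (v : Pt d) → ∣ v ⊖ v ∣² ≡ 0#
  ∣v⊖v∣² v = identityˡ-unique _ _ (polarisation v v)

  -- Prescribing x · y by a shift of v · w, rather than through the distance,
  -- avoids halving.
  distance-from-dot : ∀ {lam μ} {x y v w : Pt d} →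
    ∣ x ∣² ≡ lam → ∣ y ∣² ≡ lam → ∣ v ∣² ≡ μ → ∣ w ∣² ≡ μ →
    x · y ≡ (lam ⊞ ⊟ μ) ⊞ (v · w) → ∣ x ⊖ y ∣² ≡ ∣ v ⊖ w ∣²
  distance-from-dot {lam} {μ} {x} {y} {v} {w} xx yy vv ww xy =
    ∙-cancelʳ ((t ⊞ s) ⊞ (t ⊞ s)) _ _ (begin
      ∣ x ⊖ y ∣² ⊞ ((t ⊞ s) ⊞ (t ⊞ s))      ≡⟨ cong (λ p → ∣ x ⊖ y ∣² ⊞ (p ⊞ p)) xy ⟨
      ∣ x ⊖ y ∣² ⊞ ((x · y) ⊞ (x · y))      ≡⟨ polarisation x y ⟩
      ∣ x ∣² ⊞ ∣ y ∣²                       ≡⟨ cong₂ _⊞_ xx yy ⟩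
      lam ⊞ lam                             ≡⟨ cong₂ _⊞_ lam≡ lam≡ ⟩
      (t ⊞ μ) ⊞ (t ⊞ μ)                     ≡⟨ interchange t μ t μ ⟩
      (t ⊞ t) ⊞ (μ ⊞ μ)                     ≡⟨ cong ((t ⊞ t) ⊞_) (trans (polarisation v w) (cong₂ _⊞_ vv ww)) ⟨
      (t ⊞ t) ⊞ (∣ v ⊖ w ∣² ⊞ (s ⊞ s))      ≡⟨ ⊞-assoc (t ⊞ t) _ _ ⟨
      (t ⊞ t) ⊞ ∣ v ⊖ w ∣² ⊞ (s ⊞ s)        ≡⟨ cong (_⊞ (s ⊞ s)) (⊞-comm (t ⊞ t) _) ⟩
      ∣ v ⊖ w ∣² ⊞ (t ⊞ t) ⊞ (s ⊞ s)        ≡⟨ ⊞-assoc _ (t ⊞ t) (s ⊞ s) ⟩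
      ∣ v ⊖ w ∣² ⊞ ((t ⊞ t) ⊞ (s ⊞ s))      ≡⟨ cong (∣ v ⊖ w ∣² ⊞_) (interchange t t s s) ⟩
      ∣ v ⊖ w ∣² ⊞ ((t ⊞ s) ⊞ (t ⊞ s))      ∎)
    where
    open ≡-Reasoning
    t = lam ⊞ ⊟ μ
    s = v · w
    lam≡ : lam ≡ t ⊞ μ
    lam≡ = sym (⊞-⊟-cancelʳ lam μ)

-- Counting copies of a spherical configuration in a dense part of a sphere.

theorem2p2 : (k a b : ℕ) → 0 < a → a < b →
    Σ ℕ λ q₀ → Σ ℕ λ c₁ → Σ ℕ λ c₂ → 0 < c₁ × 0 < c₂ ×
    ((d : ℕ) → 2 * k + 6 ≤ d → (𝔽 : FiniteField) →
    ¬ (2 ∣ FiniteField.size 𝔽) → q₀ ≤ FiniteField.size 𝔽 →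
    (lam : FiniteField.Carrier 𝔽) → lam ≢ FiniteField.0# 𝔽 →
    (A : FieldOps.Pt 𝔽 d → Set) →
    (∀ x → A x → FieldOps.InSphere 𝔽 lam x) →
    (∃ λ xs → FieldOps.DistinctElems 𝔽 A xs ×
    a * FiniteField.size 𝔽 ^ (d ∸ 1) ≤ b * length xs) →
    (X : Fin (k + 2) → FieldOps.Pt 𝔽 d) → Injective _≡_ _≡_ X →
    FieldOps.Spherical 𝔽 X → FieldOps.SpansDims 𝔽 X k →
    ∃ λ ys → FieldOps.DistinctCopies 𝔽 A X ys ×
    c₁ * FiniteField.size 𝔽 ^ ((k + 1) * d ∸ (((k + 1) * (k + 2)) / 2)) ≤ c₂ * length ys)
-- The density is a / b, and the constant c is 1: the greedy count reaches the required exponent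
-- without any loss of a constant factor.
theorem2p2 k a b 0<a a<b = q₀ , 1 , 1 , s≤s z≤n , s≤s z≤n , copies
  where
  m = k + 2
  -- The 4 is for `poor-bound`. The rest makes `A`, of size at least q^(n-1) / b in dimension n,
  -- large enough for `m` blocks of 2^m q^(n-2) points.
  q₀ = 4 + b * (m * 2 ^ m)

  -- In dimension n = 2 + d the greedy exponent is at least (k + 2)(n - 2) - (k + 1)(k + 2) / 2,
  -- which exceeds the required one by n - 2k - 4.
  exponent-≤ : ∀ d → 2 * k + 6 ≤ 2 + d →
               (k + 1) * (2 + d) ∸ ((k + 1) * (k + 2)) / 2 ≤ copyExponent m d
  exponent-≤ d le = m≤n+o⇒m∸n≤o ((k + 1) * (2 + d)) _ (begin
    (k + 1) * (2 + d)                              ≡⟨ regroup₁ k d ⟩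
    (2 * k + 2) + (k + 1) * d                      ≤⟨ +-monoˡ-≤ ((k + 1) * d) 2k+2≤d ⟩
    d + (k + 1) * d                                ≡⟨ regroup₂ k d ⟩
    (k + 2) * d                                    ≤⟨ m*e≤triangular+copyExponent m d ⟩
    triangular m + copyExponent m d                ≡⟨ cong (_+ copyExponent m d) half ⟩
    ((k + 1) * (k + 2)) / 2 + copyExponent m d     ∎)
    where
    open ≤-Reasoning
    regroup₁ : ∀ k d → (k + 1) * (2 + d) ≡ (2 * k + 2) + (k + 1) * d
    regroup₁ = solve-∀
    regroup₂ : ∀ k d → d + (k + 1) * d ≡ (k + 2) * d
    regroup₂ = solve-∀
    regroup₃ : ∀ k → 2 * k + 6 ≡ 2 + (2 * k + 2 + 2)
    regroup₃ = solve-∀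
    2k+2≤d : 2 * k + 2 ≤ d
    2k+2≤d = ≤-trans (m≤m+n _ 2) (+-cancelˡ-≤ 2 _ _ (≤-trans (≤-reflexive (sym (regroup₃ k))) le))
    half : triangular m ≡ ((k + 1) * (k + 2)) / 2
    half rewrite +-comm k 1 | +-comm k 2 =
      sym (trans (/-congˡ {o = 2} (sym (triangular-double (suc k)))) (m*n/n≡m _ 2))

  copies : _
  -- The dimension is at least 6, so it can be written as 2 + d; the blocks then start with exponent
  -- d.
  copies zero          le = contradiction (m+n≤o⇒n≤o (2 * k) le) λ ()
  copies (suc zero)    le = contradiction (m+n≤o⇒n≤o (2 * k) le) λ { (s≤s ()) }
  copies (suc (suc d)) le 𝔽 _ q₀≤q lam lam≢0 A A⊆S (xs , (xs! , xs⊆A) , dense) X _ (u , μ , X⊆S) _ =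
    conclude (partition m (2 ^ m * q ^ d) xs long xs!)
    where
    open FiniteField 𝔽 using (Carrier)
      renaming (_+_ to infixl 6 _⊞_; -_ to infix 8 ⊟_; size to q)
    open Geometry 𝔽
    open Embedding 𝔽 {suc (suc d)} lam lam≢0 (s≤s z≤n) (≤-trans (m≤m+n 4 _) q₀≤q)
    open Isometry 𝔽 {suc (suc d)}

    long : m * (2 ^ m * q ^ d) ≤ length xs
    long = *-cancelˡ-≤ b {{>-nonZero (<-trans 0<a a<b)}} (begin
      b * (m * (2 ^ m * q ^ d))    ≡⟨ regroup b m (2 ^ m) (q ^ d) ⟩
      b * (m * 2 ^ m) * q ^ d      ≤⟨ *-monoˡ-≤ (q ^ d) (≤-trans (m≤n+m _ 4) q₀≤q) ⟩
      q * q ^ d                    ≤⟨ m≤n*m (q ^ suc d) a {{>-nonZero 0<a}} ⟩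
      a * q ^ suc d                ≤⟨ dense ⟩
      b * length xs                ∎)
      where
      open ≤-Reasoning
      regroup : ∀ b m t r → b * (m * (t * r)) ≡ b * (m * t) * r
      regroup = solve-∀

    -- The starting condition of `embed` is equivalent to the assumed bound 2k + 6 on the dimension.
    dimension : suc (suc d) + 2 * m ≤ 2 + 2 * d
    dimension = begin
      suc (suc d) + 2 * (k + 2)    ≡⟨ regroup₁ d k ⟩
      d + (2 * k + 6)              ≤⟨ +-monoʳ-≤ d le ⟩
      d + (2 + d)                  ≡⟨ regroup₂ d ⟩
      2 + 2 * d                    ∎
      where
      open ≤-Reasoning
      regroup₁ : ∀ d k → suc (suc d) + 2 * (k + 2) ≡ d + (2 * k + 6)
      regroup₁ = solve-∀
      regroup₂ : ∀ d → d + (2 + d) ≡ 2 + 2 * d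
      regroup₂ = solve-∀

    -- The Gram matrix of `X` recentred at `u`, shifted so that its diagonal entries μ become `lam`.
    G : Fin m → Fin m → Carrier
    G i j = (lam ⊞ ⊟ μ) ⊞ ((X i ⊖ u) · (X j ⊖ u))

    conclude : _ → _
    conclude (L , L! , L⊆xs , s≤ , disjoint)
      with ys , ys! , realised , N≤ ← embed m d G L L!
             (λ i → All.tabulate λ y∈ → A⊆S _ (All.lookup xs⊆A (L⊆xs i y∈))) s≤ dimension =
      ys , (AllPairs-map-All differ realised ys! , All.map isCopy realised) ,
      *-monoʳ-≤ 1 (≤-trans (^-monoʳ-≤ q (exponent-≤ d le)) N≤)
      where
      -- A vertex common to both sets lies in a single block and so has the same index in both
      -- tuples; equal sets would force equal tuples.
      differ : ∀ {y y'} → Realises G L y → Realises G L y' → ¬ (∀ i → y i ≡ y' i) → ¬ SameSet y y'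
      differ {y' = y'} (y∈ , _) (y'∈ , _) y≢y' (y⊆y' , _) = y≢y' λ i →
        let j , yi≡y'j = y⊆y' i
            i≡j = disjoint (y∈ i) (subst (_∈ L j) (sym yi≡y'j) (y'∈ j))
        in trans yi≡y'j (cong y' (sym i≡j))

      isCopy : ∀ {y} → Realises G L y → IsCopy A X y
      isCopy {y} (y∈ , dots) = injective , y∈A , distance
        where
        injective : Injective _≡_ _≡_ y
        injective {i} {j} yi≡yj = disjoint (y∈ i) (subst (_∈ L j) (sym yi≡yj) (y∈ j))
        y∈A : ∀ i → A (y i)
        y∈A i = All.lookup xs⊆A (L⊆xs i (y∈ i))
        from-dot : ∀ i j → y i · y j ≡ G i j → ∣ y i ⊖ y j ∣² ≡ ∣ X i ⊖ X j ∣²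
        from-dot i j eq = trans
          (distance-from-dot {x = y i} {y = y j} {v = X i ⊖ u} {w = X j ⊖ u} (A⊆S _ (y∈A i)) (A⊆S _ (y∈A j)) (X⊆S i) (X⊆S j) eq)
          (cong ∣_∣² (⊖-⊖-cancel (X i) (X j) u))
        distance : ∀ i j → ∣ y i ⊖ y j ∣² ≡ ∣ X i ⊖ X j ∣²
        distance i j with Fin.<-cmp i j
        ... | tri< i<j _ _  = from-dot i j (dots i j i<j)
        ... | tri≈ _ refl _ = trans (∣v⊖v∣² (y i)) (sym (∣v⊖v∣² (X i)))
        ... | tri> _ _ j<i  = from-dot i j (trans (dot-comm (y i) (y j))
          (trans (dots j i j<i) (cong ((lam ⊞ ⊟ μ) ⊞_) (dot-comm (X j ⊖ u) (X i ⊖ u)))))
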